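{- Let $(B_i)_{i\ge 0}$ be the sequence of finite binary words obtained from $B_0=00$ by iterating Kimberling's inflation rules $0\mapsto 0$, $1\mapsto 10$, $00\mapsto 0101$ (as described in the context). Let $c_0=2$, $c_1=4$, $c_2=6$, $c_3=10$, and define $c_i=2c_{i-1}-c_{i-4}$ for $i\ge 4$. Then $|B_i|=c_i$ for all $i\ge 0$, where $|B_i|$ denotes the length of $B_i$.
   Context: Definition of the words $B_i$ over $\{0,1\}$: $B_0=00$. Given $B_i$, factor it into blocks as follows: each letter $1$ is a block by itself, and each maximal run of consecutive $0$'s is a block, which is either $0$ (run of length 1) or $00$ (run of length 2) (runs of three or more $0$'s never occur). Then $B_{i+1}$ is obtained by replacing each block $0$ by $0$, each block $1$ by $10$, and each block $00$ by $0101$, and concatenating in order. For example $B_1=0101$, $B_2=010010$, $B_3=0100101100$, $B_4=010010110010100101$. -}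

module Defs where

open import Data.Fin.Base using (Fin)
open import Data.Fin.Patterns using (0F; 1F)
open import Data.Integer.Base using (ℤ; +_; _-_; _*_)
open import Data.List.Base using (List; []; _∷_; concatMap)
open import Data.List.Relation.Binary.Infix.Heterogeneous using (Infix; here; there)
open import Data.List.Relation.Binary.Prefix.Heterogeneous using (_∷_)
open import Data.Nat.Base using (ℕ; zero; suc)
open import Data.Product.Base using (_×_; _,_; proj₁; proj₂)
open import Relation.Binary.PropositionalEquality using (_≡_; refl)
open import Relation.Nullary.Negation using (¬_)

Word : Set
Word = List (Fin 2)

data Block : Set where
  [0] [1] [00] : Block

-- On words without the factor 000, this left-to-right factorization has the
-- maximal runs of 0's as its zero blocks. The choice made for longer runs is
-- immaterial: they never occur in B i (see B-no-000).
blocks : Word → List Block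
blocks []             = []
blocks (1F ∷ w)       = [1] ∷ blocks w
blocks (0F ∷ 0F ∷ w)  = [00] ∷ blocks w
blocks (0F ∷ [])      = [0] ∷ []
blocks (0F ∷ 1F ∷ w)  = [0] ∷ [1] ∷ blocks w

replace : Block → Word
replace [0]  = 0F ∷ []
replace [1]  = 1F ∷ 0F ∷ []
replace [00] = 0F ∷ 1F ∷ 0F ∷ 1F ∷ []

inflate : Word → Word
inflate w = concatMap replace (blocks w)

B : ℕ → Word
B zero    = 0F ∷ 0F ∷ []
B (suc i) = inflate (B i)

-- Integer-valued, so that the subtraction is not truncated.
c : ℕ → ℤ
c 0 = + 2
c 1 = + 4
c 2 = + 6
c 3 = + 10
c (suc (suc (suc (suc i)))) = + 2 * c (suc (suc (suc i))) - c i

_ : B 3 ≡ 0F ∷ 1F ∷ 0F ∷ 0F ∷ 1F ∷ 0F ∷ 1F ∷ 1F ∷ 0F ∷ 0F ∷ []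
_ = refl

_ : B 4 ≡ 0F ∷ 1F ∷ 0F ∷ 0F ∷ 1F ∷ 0F ∷ 1F ∷ 1F ∷ 0F ∷ 0F ∷ 1F ∷ 0F ∷ 1F ∷ 0F ∷ 0F ∷ 1F ∷ 0F ∷ 1F ∷ []
_ = refl

-- Words all of whose maximal runs of 0's have length at most 2.
data ShortRuns : Word → Set where
  ε    : ShortRuns []
  1∷_  : ∀ {w} → ShortRuns w → ShortRuns (1F ∷ w)
  0∷ε  : ShortRuns (0F ∷ [])
  01∷_ : ∀ {w} → ShortRuns w → ShortRuns (0F ∷ 1F ∷ w)
  00∷ε : ShortRuns (0F ∷ 0F ∷ [])
  001∷_ : ∀ {w} → ShortRuns w → ShortRuns (0F ∷ 0F ∷ 1F ∷ w)

inflate-shortRuns : ∀ {w} → ShortRuns w →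
                    ShortRuns (inflate w) × ShortRuns (0F ∷ inflate w)
inflate-shortRuns ε        = ε , 0∷ε
inflate-shortRuns (1∷ s)   = let p = proj₂ (inflate-shortRuns s) in 1∷ p , 01∷ p
inflate-shortRuns 0∷ε      = 0∷ε , 00∷ε
inflate-shortRuns (01∷ s)  = let p = proj₂ (inflate-shortRuns s) in 01∷ p , 001∷ p
inflate-shortRuns 00∷ε     = 01∷ (01∷ ε) , 001∷ (01∷ ε)
inflate-shortRuns (001∷ s) = let p = 01∷ (1∷ proj₂ (inflate-shortRuns s)) in 01∷ p , 001∷ p

B-shortRuns : ∀ i → ShortRuns (B i)
B-shortRuns zero    = 00∷ε
B-shortRuns (suc i) = proj₁ (inflate-shortRuns (B-shortRuns i))

shortRuns⇒no-000 : ∀ {w} → ShortRuns w → ¬ Infix _≡_ (0F ∷ 0F ∷ 0F ∷ []) w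
shortRuns⇒no-000 ε        (here ())
shortRuns⇒no-000 (1∷ s)   (here (() ∷ _))
shortRuns⇒no-000 (1∷ s)   (there p) = shortRuns⇒no-000 s p
shortRuns⇒no-000 0∷ε      (here (_ ∷ ()))
shortRuns⇒no-000 0∷ε      (there p) = shortRuns⇒no-000 ε p
shortRuns⇒no-000 (01∷ s)  (here (_ ∷ () ∷ _))
shortRuns⇒no-000 (01∷ s)  (there p) = shortRuns⇒no-000 (1∷ s) p
shortRuns⇒no-000 00∷ε     (here (_ ∷ _ ∷ ()))
shortRuns⇒no-000 00∷ε     (there p) = shortRuns⇒no-000 0∷ε p
shortRuns⇒no-000 (001∷ s) (here (_ ∷ _ ∷ () ∷ _))
shortRuns⇒no-000 (001∷ s) (there p) = shortRuns⇒no-000 (01∷ s) p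

B-no-000 : ∀ i → ¬ Infix _≡_ (0F ∷ 0F ∷ 0F ∷ []) (B i)
B-no-000 i = shortRuns⇒no-000 (B-shortRuns i)

{-# OPTIONS --safe #-}
-- In a word that starts with 0 and has short 0-runs, every zero block except the
-- first is preceded by a 1. The image 10 of that 1 ends in a 0, which joins the
-- leading 0 of the next image to form a run 00. The block counts of inflate w
-- are therefore affine functions of those of w. We use the transpose of this
-- map: a weight φ on the blocks of inflate w becomes the weight pullback φ on
-- the blocks of w, up to a constant. The length is the total weight for size,
-- and pullback⁴ size = 2 pullback³ size − size.
module Submission where

open import Data.Fin.Patterns using (0F; 1F)
open import Data.Integer.Base using (ℤ; +_; -[1+_]; 0ℤ; _+_; _-_; _*_)
open import Data.Integer.Tactic.RingSolver using (solve-∀)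
open import Data.List.Base using (List; []; _∷_; head; length)
open import Data.Maybe.Base using (just)
open import Data.Nat.Base using (ℕ; zero; suc)
open import Relation.Binary.PropositionalEquality using (_≡_; refl; trans; cong; cong₂; module ≡-Reasoning)
open import Defs

Weight : Set
Weight = Block → ℤ

total : Weight → List Block → ℤ
total φ []       = 0ℤ
total φ (b ∷ bs) = φ b + total φ bs

size : Weight
size [0]  = + 1
size [1]  = + 1
size [00] = + 2

length≡total-size : ∀ w → + length w ≡ total size (blocks w)
length≡total-size []            = refl
length≡total-size (1F ∷ w)      = cong (_+_ (+ 1)) (length≡total-size w)
length≡total-size (0F ∷ [])     = refl
length≡total-size (0F ∷ 0F ∷ w) = cong (_+_ (+ 2)) (length≡total-size w)
length≡total-size (0F ∷ 1F ∷ w) =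
  cong (λ n → + 1 + (+ 1 + n)) (length≡total-size w)

-- Once a run is extended by a preceding 0, the block 0 becomes 00 and 00 becomes
-- 00·1·0·1. A block 1 is charged for its 0 as if that stayed a single run, and
-- the block 0 that absorbs it refunds φ [0]; in 00·1·0·1 the refund cancels the
-- single 0.
pullback : Weight → Weight
pullback φ [0]  = φ [00] - φ [0]
pullback φ [1]  = φ [1] + φ [0]
pullback φ [00] = φ [00] + + 2 * φ [1]

-- The prepended 0 stands for the last 0 of a preceding image 10. Each 1 in `w` passes its own final
-- 0 on to the rest in the same way, so the induction closes on this form.
total-0∷inflate : ∀ φ {w} → ShortRuns w →
  total φ (blocks (0F ∷ inflate w)) ≡ φ [0] + total (pullback φ) (blocks w)
total-0∷inflate φ ε = refl
total-0∷inflate φ (1∷ s) =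
  trans (cong (λ t → φ [0] + (φ [1] + t)) (total-0∷inflate φ s))
        (eq (φ [0]) (φ [1]) _)
  where
  eq : ∀ p q t → p + (q + (p + t)) ≡ p + (q + p + t)
  eq = solve-∀
total-0∷inflate φ 0∷ε = eq (φ [0]) (φ [00])
  where
  eq : ∀ p r → r + 0ℤ ≡ p + (r - p + 0ℤ)
  eq = solve-∀
total-0∷inflate φ (01∷ s) =
  trans (cong (λ t → φ [00] + (φ [1] + t)) (total-0∷inflate φ s))
        (eq (φ [0]) (φ [1]) (φ [00]) _)
  where
  eq : ∀ p q r t → r + (q + (p + t)) ≡ p + (r - p + (q + p + t))
  eq = solve-∀
total-0∷inflate φ 00∷ε = eq (φ [0]) (φ [1]) (φ [00])
  where
  eq : ∀ p q r → r + (q + (p + (q + 0ℤ))) ≡ p + (r + + 2 * q + 0ℤ)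
  eq = solve-∀
total-0∷inflate φ (001∷ s) =
  trans (cong (λ t → φ [00] + (φ [1] + (φ [0] + (φ [1] + (φ [1] + t)))))
              (total-0∷inflate φ s))
        (eq (φ [0]) (φ [1]) (φ [00]) _)
  where
  eq : ∀ p q r t → r + (q + (p + (q + (q + (p + t))))) ≡
                   p + (r + + 2 * q + (q + p + t))
  eq = solve-∀

-- The first zero block has no 0 before its image, which thus opens with a run 0 instead of 00.
-- Trading `φ [00]` for `φ [0]` turns the constant `φ [0]` of `total-0∷inflate` into this one.
offset : Weight → ℤ
offset φ = + 2 * φ [0] - φ [00]

total-inflate : ∀ φ {w} → ShortRuns w → head w ≡ just 0F →
  total φ (blocks (inflate w)) ≡
  offset φ + total (pullback φ) (blocks w)
total-inflate φ 0∷ε _ = eq (φ [0]) (φ [00])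
  where
  eq : ∀ p r → p + 0ℤ ≡ + 2 * p - r + (r - p + 0ℤ)
  eq = solve-∀
total-inflate φ (01∷ s) _ =
  trans (cong (λ t → φ [0] + (φ [1] + t)) (total-0∷inflate φ s))
        (eq (φ [0]) (φ [1]) (φ [00]) _)
  where
  eq : ∀ p q r t → p + (q + (p + t)) ≡ + 2 * p - r + (r - p + (q + p + t))
  eq = solve-∀
total-inflate φ 00∷ε _ = eq (φ [0]) (φ [1]) (φ [00])
  where
  eq : ∀ p q r → p + (q + (p + (q + 0ℤ))) ≡
                 + 2 * p - r + (r + + 2 * q + 0ℤ)
  eq = solve-∀
total-inflate φ (001∷ s) _ =
  trans (cong (λ t → φ [0] + (φ [1] + (φ [0] + (φ [1] + (φ [1] + t)))))
              (total-0∷inflate φ s))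
        (eq (φ [0]) (φ [1]) (φ [00]) _)
  where
  eq : ∀ p q r t → p + (q + (p + (q + (q + (p + t))))) ≡
                   + 2 * p - r + (r + + 2 * q + (q + p + t))
  eq = solve-∀

-- Each replacement begins with the first letter of its block.
head-inflate : ∀ w → head (inflate w) ≡ head w
head-inflate []            = refl
head-inflate (1F ∷ w)      = refl
head-inflate (0F ∷ [])     = refl
head-inflate (0F ∷ 0F ∷ w) = refl
head-inflate (0F ∷ 1F ∷ w) = refl

head-B : ∀ i → head (B i) ≡ just 0F
head-B zero    = refl
head-B (suc i) = trans (head-inflate (B i)) (head-B i)

total-B : ∀ φ i → total φ (blocks (B (suc i))) ≡
  offset φ + total (pullback φ) (blocks (B i))
total-B φ i = total-inflate φ (B-shortRuns i) (head-B i)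

total-2*- : ∀ {φ ψ χ : Weight} → (∀ b → χ b ≡ + 2 * φ b - ψ b) →
  ∀ bs → total χ bs ≡ + 2 * total φ bs - total ψ bs
total-2*- χ≡ []       = refl
total-2*- {φ} {ψ} χ≡ (b ∷ bs) =
  trans (cong₂ _+_ (χ≡ b) (total-2*- {φ} {ψ} χ≡ bs)) (eq (φ b) (ψ b) _ _)
  where
  eq : ∀ x y s t → + 2 * x - y + (+ 2 * s - t) ≡ + 2 * (x + s) - (y + t)
  eq = solve-∀

pullback³ : Weight → Weight
pullback³ φ = pullback (pullback (pullback φ))

-- The linear map `pullback` has characteristic polynomial x³ - x² - x - 1, and multiplying it by x
-- - 1 gives x⁴ - 2x³ + 1.
pullback⁴-size : ∀ b → pullback (pullback³ size) b ≡ + 2 * pullback³ size b - size b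
pullback⁴-size [0]  = refl
pullback⁴-size [1]  = refl
pullback⁴-size [00] = refl

total-B³ : ∀ φ i → total φ (blocks (B (suc (suc (suc i))))) ≡
  offset φ + (offset (pullback φ) + (offset (pullback (pullback φ)) +
    total (pullback³ φ) (blocks (B i))))
total-B³ φ i = begin
  total φ (blocks (B (suc (suc (suc i)))))
    ≡⟨ total-B φ (suc (suc i)) ⟩
  offset φ + total (pullback φ) (blocks (B (suc (suc i))))
    ≡⟨ cong (_+_ (offset φ)) (total-B (pullback φ) (suc i)) ⟩
  offset φ + (offset (pullback φ) + total (pullback (pullback φ)) (blocks (B (suc i))))
    ≡⟨ cong (λ t → offset φ + (offset (pullback φ) + t)) (total-B (pullback (pullback φ)) i) ⟩
  offset φ + (offset (pullback φ) + (offset (pullback (pullback φ)) +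
    total (pullback³ φ) (blocks (B i)))) ∎
  where open ≡-Reasoning

total-size-recurrence : ∀ i → total size (blocks (B (suc (suc (suc (suc i)))))) ≡
  + 2 * total size (blocks (B (suc (suc (suc i))))) - total size (blocks (B i))
total-size-recurrence i = begin
  total size (blocks (B (suc (suc (suc (suc i))))))
    ≡⟨ total-B size (suc (suc (suc i))) ⟩
  0ℤ + total (pullback size) (blocks (B (suc (suc (suc i)))))
    ≡⟨ cong (_+_ 0ℤ) (total-B³ (pullback size) i) ⟩
  -- The constants 0, -2, -2, -4 are the offsets of `size` and of its first three pullbacks.
  0ℤ + (-[1+ 1 ] + (-[1+ 1 ] + (-[1+ 3 ] + total (pullback (pullback³ size)) (blocks (B i)))))
    ≡⟨ cong (λ t → 0ℤ + (-[1+ 1 ] + (-[1+ 1 ] + (-[1+ 3 ] + t))))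
            (total-2*- {pullback³ size} {size} pullback⁴-size (blocks (B i))) ⟩
  0ℤ + (-[1+ 1 ] + (-[1+ 1 ] + (-[1+ 3 ] + (+ 2 * total (pullback³ size) (blocks (B i)) - total size (blocks (B i))))))
    -- All four offsets sum to -8, twice the sum -4 of the first three, so no constant survives in
    -- the recurrence.
    ≡⟨ eq (total (pullback³ size) (blocks (B i))) (total size (blocks (B i))) ⟩
  + 2 * (0ℤ + (-[1+ 1 ] + (-[1+ 1 ] + total (pullback³ size) (blocks (B i))))) - total size (blocks (B i))
    ≡⟨ cong (λ t → + 2 * t - total size (blocks (B i))) (total-B³ size i) ⟨
  + 2 * total size (blocks (B (suc (suc (suc i))))) - total size (blocks (B i)) ∎
  where
  open ≡-Reasoning
  eq : ∀ s t → 0ℤ + (-[1+ 1 ] + (-[1+ 1 ] + (-[1+ 3 ] + (+ 2 * s - t)))) ≡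
               + 2 * (0ℤ + (-[1+ 1 ] + (-[1+ 1 ] + s))) - t
  eq = solve-∀

total-size-B : ∀ i → total size (blocks (B i)) ≡ c i
total-size-B 0 = refl
total-size-B 1 = refl
total-size-B 2 = refl
total-size-B 3 = refl
total-size-B (suc (suc (suc (suc i)))) =
  trans (total-size-recurrence i)
        (cong₂ (λ s t → + 2 * s - t) (total-size-B (suc (suc (suc i)))) (total-size-B i))

proposition1 : (i : ℕ) → + length (B i) ≡ c i
proposition1 i = trans (length≡total-size (B i)) (total-size-B i)
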